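{- If $A\in 2^\omega$ is $1$-generic, then the many-one degree $\deg_m(A)$ contains an infinite antichain of $1$-degrees; that is, there is an infinite sequence $(B_i)_{i\in\omega}$ of subsets of $\omega$ such that $B_i\equiv_m A$ for every $i$ and $B_i\not\le_1 B_j$ for all $i\neq j$.
   Context: $\omega=\{0,1,2,\dots\}$; sets $A\subseteq\omega$ are identified with their characteristic functions in Cantor space $2^\omega$, and $2^{<\omega}$ is the set of finite binary strings. A set $A\in 2^\omega$ is $1$-generic if for every computably enumerable set of strings $W\subseteq 2^{<\omega}$ there exists an initial segment $\sigma$ of $A$ such that either $\sigma\in W$, or no extension of $\sigma$ belongs to $W$. For $A,B\subseteq\omega$: $A\le_m B$ if there is a total computable function $f:\omega\to\omega$ such that for all $x$, $x\in A\iff f(x)\in B$; $A\le_1 B$ if there is such an $f$ which is moreover injective. $A\equiv_m B$ means $A\le_m B$ and $B\le_m A$; $A\equiv_1 B$ means $A\le_1 B$ and $B\le_1 A$. $\deg_m(A)=\{X\subseteq\omega: X\equiv_m A\}$ and $\deg_1(A)=\{X\subseteq\omega: X\equiv_1 A\}$. -}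

module Defs where

open import Data.Bool.Base using (Bool; true; false)
open import Data.Fin.Base using (Fin)
open import Data.List.Base using (List; []; _∷_; length; applyUpTo)
open import Data.List.Relation.Binary.Prefix.Heterogeneous using (Prefix)
open import Data.Nat.Base using (ℕ; zero; suc; _+_; _*_; _<_)
open import Data.Product.Base using (∃-syntax; _×_)
open import Data.Sum.Base using (_⊎_)
open import Data.Vec.Base using (Vec; []; _∷_; lookup)
open import Data.Vec.Relation.Binary.Pointwise.Inductive using (Pointwise)
open import Function.Bundles using (_⇔_)
open import Function.Definitions using (Injective)
open import Level using (0ℓ)
open import Relation.Binary.PropositionalEquality.Core using (_≡_)
open import Relation.Nullary.Negation.Core using (¬_)
open import Relation.Unary using (Pred)

-- Programs for the n-ary partial recursive (μ-recursive) functions.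
data Rec : ℕ → Set where
  zeroʳ : Rec 0
  sucʳ  : Rec 1
  projʳ : ∀ {n} → Fin n → Rec n
  compʳ : ∀ {m n} → Rec m → Vec (Rec n) m → Rec n
  precʳ : ∀ {n} → Rec n → Rec (2 + n) → Rec (suc n)
  μʳ    : ∀ {n} → Rec (suc n) → Rec n

infix 4 _[_]⇓_

-- p [ xs ]⇓ y : the program p halts on input xs with output y.
data _[_]⇓_ : ∀ {n} → Rec n → Vec ℕ n → ℕ → Set where
  ⇓zero  : zeroʳ [ [] ]⇓ 0
  ⇓suc   : ∀ {x} → sucʳ [ x ∷ [] ]⇓ suc x
  ⇓proj  : ∀ {n} {i : Fin n} {xs} → projʳ i [ xs ]⇓ lookup xs i
  ⇓comp  : ∀ {m n} {f : Rec m} {gs : Vec (Rec n) m} {xs ys z} →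
           Pointwise (λ g y → g [ xs ]⇓ y) gs ys →
           f [ ys ]⇓ z →
           compʳ f gs [ xs ]⇓ z
  ⇓prec₀ : ∀ {n} {f : Rec n} {g xs y} →
           f [ xs ]⇓ y →
           precʳ f g [ zero ∷ xs ]⇓ y
  ⇓precₛ : ∀ {n} {f : Rec n} {g xs k r y} →
           precʳ f g [ k ∷ xs ]⇓ r →
           g [ k ∷ r ∷ xs ]⇓ y →
           precʳ f g [ suc k ∷ xs ]⇓ y
  -- Every value below the least zero must be defined (and nonzero).
  ⇓μ     : ∀ {n} {f : Rec (suc n)} {xs y} →
           f [ y ∷ xs ]⇓ 0 →
           (∀ z → z < y → ∃[ k ] f [ z ∷ xs ]⇓ suc k) →
           μʳ f [ xs ]⇓ y

Computable : (ℕ → ℕ) → Set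
Computable f = ∃[ p ] (∀ x → p [ x ∷ [] ]⇓ f x)

BinString : Set
BinString = List Bool

-- Bijective base-2 numeration (digits false ↦ 1, true ↦ 2, least significant
-- digit first): an effective bijection between finite binary strings and ℕ.
code : BinString → ℕ
code []          = 0
code (false ∷ σ) = 1 + 2 * code σ
code (true  ∷ σ) = 2 + 2 * code σ

-- W is the domain of a partial recursive function (via code).
CE : Pred BinString 0ℓ → Set
CE W = ∃[ p ] (∀ σ → W σ ⇔ (∃[ y ] p [ code σ ∷ [] ]⇓ y))

-- Subsets of ω, given by their characteristic functions.
2^ω : Set
2^ω = ℕ → Bool

infix 4 _∈_ _≺_ _⊑_ _≤m_ _≤₁_ _≡m_

_∈_ : ℕ → 2^ω → Set
x ∈ A = A x ≡ true

_≺_ : BinString → 2^ω → Set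
σ ≺ A = σ ≡ applyUpTo A (length σ)

-- Non-strict: every string extends itself.
_⊑_ : BinString → BinString → Set
_⊑_ = Prefix _≡_

1-Generic : 2^ω → Set₁
1-Generic A = ∀ (W : Pred BinString 0ℓ) → CE W →
  ∃[ σ ] (σ ≺ A × (W σ ⊎ (∀ τ → σ ⊑ τ → ¬ W τ)))

_≤m_ : 2^ω → 2^ω → Set
A ≤m B = ∃[ f ] (Computable f × (∀ x → x ∈ A ⇔ f x ∈ B))

_≤₁_ : 2^ω → 2^ω → Set
A ≤₁ B = ∃[ f ] (Computable f × Injective _≡_ _≡_ f × (∀ x → x ∈ A ⇔ f x ∈ B))

_≡m_ : 2^ω → 2^ω → Set
A ≡m B = A ≤m B × B ≤m A

{-# OPTIONS --safe #-}

-- Put B i = A ∘ copies i, where copies i takes each value 2^i (2k+1) twice and every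
-- other value once.  If A is 1-generic and A ∘ g = A ∘ h with g, h computable, then
-- h x = g x as soon as g x is large: otherwise the c.e. set of strings σ with
-- σ(g x) ≠ σ(h x) for some x is dense along A, so it is met by A.  Hence a reduction
-- f of B i to B j satisfies copies j (f x) = copies i x whenever copies i x is large,
-- so for large k it maps the two preimages of 2^i (2k+1) under copies i to the only
-- preimage under copies j, and f is not injective.
module Submission where

open import Defs
open import Data.Bool.Base using (Bool; true; false; not)
open import Data.Bool.Properties using (⇔→≡)
open import Data.Empty using (⊥-elim)
open import Data.Fin.Base using (Fin; zero; suc)
open import Data.List.Base using ([]; _∷_; length; applyUpTo)
open import Data.List.Relation.Binary.Prefix.Heterogeneous using ([]; _∷_)
open import Data.Nat.Base using (ℕ; zero; suc; pred; _+_; _*_; _<_; _≤_; z≤n; s≤s; s<s; z<s; ⌊_/2⌋)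
open import Data.Nat.GeneralisedArithmetic using (fold; iterate-is-fold)
open import Data.Nat.Properties
open import Data.Product.Base using (Σ-syntax; ∃-syntax; _×_; _,_; proj₁; proj₂)
open import Data.Sum.Base using (_⊎_; inj₁; inj₂)
open import Data.Vec.Base using (Vec; []; _∷_; lookup)
open import Data.Vec.Relation.Binary.Pointwise.Inductive using (Pointwise; []; _∷_)
open import Function.Base using (_∘_; id)
open import Function.Bundles using (mk⇔)
open import Relation.Binary.Definitions using (tri<; tri≈; tri>)
open import Relation.Binary.PropositionalEquality
open import Relation.Nullary.Decidable.Core using (yes; no)
open import Relation.Nullary.Negation.Core using (¬_)

-- Recursive functions

mutual
  -- Needed to read a zero of a total function off a halting search. In the `⇓μ` case the smaller of
  -- two distinct outputs would be a zero and, lying below the larger, also a nonzero value.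
  ⇓-deterministic : ∀ {n} {p : Rec n} {xs y z} → p [ xs ]⇓ y → p [ xs ]⇓ z → y ≡ z
  ⇓-deterministic ⇓zero ⇓zero = refl
  ⇓-deterministic ⇓suc ⇓suc = refl
  ⇓-deterministic ⇓proj ⇓proj = refl
  ⇓-deterministic (⇓comp gs f) (⇓comp gs′ f′) with refl ← ⇓-deterministic* gs gs′ =
    ⇓-deterministic f f′
  ⇓-deterministic (⇓prec₀ f) (⇓prec₀ f′) = ⇓-deterministic f f′
  ⇓-deterministic (⇓precₛ r g) (⇓precₛ r′ g′) with refl ← ⇓-deterministic r r′ =
    ⇓-deterministic g g′
  ⇓-deterministic (⇓μ {y = y} f below) (⇓μ {y = z} f′ below′) with <-cmp y z
  ... | tri≈ _ y≡z _ = y≡z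
  ... | tri< y<z _ _ with _ , g ← below′ y y<z = ⊥-elim (0≢1+n (⇓-deterministic f g))
  ... | tri> _ _ z<y with _ , g ← below z z<y = ⊥-elim (1+n≢0 (⇓-deterministic g f′))

  ⇓-deterministic* : ∀ {m n} {gs : Vec (Rec n) m} {xs ys zs} →
    Pointwise (λ g y → g [ xs ]⇓ y) gs ys → Pointwise (λ g z → g [ xs ]⇓ z) gs zs → ys ≡ zs
  ⇓-deterministic* [] [] = refl
  ⇓-deterministic* (g ∷ gs) (g′ ∷ gs′) =
    cong₂ _∷_ (⇓-deterministic g g′) (⇓-deterministic* gs gs′)

Computableⁿ : ∀ {n} → (Vec ℕ n → ℕ) → Set
Computableⁿ F = ∃[ p ] (∀ xs → p [ xs ]⇓ F xs)

Computable₂ : (ℕ → ℕ → ℕ) → Set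
Computable₂ f = Computableⁿ {2} (λ xs → f (lookup xs zero) (lookup xs (suc zero)))

unary : ∀ {f} → Computableⁿ {1} (λ xs → f (lookup xs zero)) → Computable f
unary (p , p⇓) = p , λ x → p⇓ (x ∷ [])

proj-computable : ∀ {n} (i : Fin n) → Computableⁿ (λ xs → lookup xs i)
proj-computable i = projʳ i , λ _ → ⇓proj

id-computable : Computable id
id-computable = unary (proj-computable zero)

suc-computable : Computable suc
suc-computable = sucʳ , λ _ → ⇓suc

∘ⁿ-computable : ∀ {n f} {G : Vec ℕ n → ℕ} →
  Computable f → Computableⁿ G → Computableⁿ (λ xs → f (G xs))
∘ⁿ-computable (p , p⇓) (q , q⇓) = compʳ p (q ∷ []) , λ xs → ⇓comp (q⇓ xs ∷ []) (p⇓ _)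

∘₂ⁿ-computable : ∀ {n} f {G H : Vec ℕ n → ℕ} →
  Computable₂ f → Computableⁿ G → Computableⁿ H → Computableⁿ (λ xs → f (G xs) (H xs))
∘₂ⁿ-computable _ (p , p⇓) (q , q⇓) (r , r⇓) =
  compʳ p (q ∷ r ∷ []) , λ xs → ⇓comp (q⇓ xs ∷ r⇓ xs ∷ []) (p⇓ _)

∘-computable : ∀ {f g} → Computable f → Computable g → Computable (f ∘ g)
∘-computable cf cg = unary (∘ⁿ-computable cf (∘ⁿ-computable cg (proj-computable zero)))

∘₂-computable : ∀ f {g h} →
  Computable₂ f → Computable g → Computable h → Computable (λ x → f (g x) (h x))
∘₂-computable f cf cg ch = unary (∘₂ⁿ-computable f cf
  (∘ⁿ-computable cg (proj-computable zero)) (∘ⁿ-computable ch (proj-computable zero)))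

constⁿ-computable : ∀ {n} c → Computableⁿ {n} (λ _ → c)
constⁿ-computable zero    = compʳ zeroʳ [] , λ _ → ⇓comp [] ⇓zero
constⁿ-computable (suc c) = ∘ⁿ-computable suc-computable (constⁿ-computable c)

const-computable : ∀ c → Computable (λ _ → c)
const-computable c = unary (constⁿ-computable c)

-- The recursion equation is a propositional hypothesis, so that functions like `odd` and `⌊_/2⌋`,
-- which recurse two steps at a time, are covered too.
prec-computable : ∀ {n} (F : Vec ℕ (suc n) → ℕ) {S : Vec ℕ (2 + n) → ℕ} →
  Computableⁿ (λ xs → F (0 ∷ xs)) → Computableⁿ S →
  (∀ k xs → F (suc k ∷ xs) ≡ S (k ∷ F (k ∷ xs) ∷ xs)) → Computableⁿ F
prec-computable F (p , p⇓) (q , q⇓) F-suc = precʳ p q , λ { (k ∷ xs) → rec k xs }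
  where
  rec : ∀ k xs → precʳ p q [ k ∷ xs ]⇓ F (k ∷ xs)
  rec zero    xs = ⇓prec₀ (p⇓ xs)
  rec (suc k) xs =
    subst (precʳ p q [ suc k ∷ xs ]⇓_) (sym (F-suc k xs)) (⇓precₛ (rec k xs) (q⇓ _))

-- A case distinction on zero is a primitive recursion whose step ignores the recursive value.
shift-computable : ∀ f → Computable (f ∘ suc) → Computable f
shift-computable f cf = unary (prec-computable (λ xs → f (lookup xs zero))
  (constⁿ-computable (f 0)) (∘ⁿ-computable cf (proj-computable zero)) (λ _ _ → refl))

fold-computable : ∀ {f} → Computable f → Computable₂ (λ n x → fold x f n)
fold-computable cf = prec-computable _ (proj-computable zero)
  (∘ⁿ-computable cf (proj-computable (suc zero))) (λ _ _ → refl)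

+-computable : Computable₂ _+_
+-computable = prec-computable _ (proj-computable zero)
  (∘ⁿ-computable suc-computable (proj-computable (suc zero))) (λ _ _ → refl)

double-computable : Computable (λ n → n + n)
double-computable = ∘₂-computable _+_ +-computable id-computable id-computable

-- Unbounded search: halting on `c` amounts to the existence of a zero of `f` at `c`, which is how a
-- set of strings is shown to be c.e. below.
μ-computable : (f : ℕ → ℕ → ℕ) → Computable₂ f →
  ∃[ p ] (∀ c → (∀ x → f x c ≡ 0 → ∃[ y ] p [ c ∷ [] ]⇓ y) ×
                (∀ y → p [ c ∷ [] ]⇓ y → f y c ≡ 0))
μ-computable f (p , p⇓) = μʳ p , λ c → least c , zero-of c
  where
  -- `k` is the current candidate and `x` the distance to a known zero, which bounds the search.
  search : ∀ c x k → (∀ z → z < k → ∃[ v ] f z c ≡ suc v) → f (x + k) c ≡ 0 →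
    ∃[ y ] (f y c ≡ 0 × (∀ z → z < y → ∃[ v ] f z c ≡ suc v))
  search c x k below fx≡0 with f k c in fk
  search c x       k below fx≡0 | zero  = k , fk , below
  search c zero    k below fx≡0 | suc v = ⊥-elim (1+n≢0 (trans (sym fk) fx≡0))
  search c (suc x) k below fx≡0 | suc v =
    search c x (suc k) below′ (trans (cong (λ y → f y c) (+-suc x k)) fx≡0)
    where
    below′ : ∀ z → z < suc k → ∃[ v ] f z c ≡ suc v
    below′ z z<1+k with m≤n⇒m<n∨m≡n (≤-pred z<1+k)
    ... | inj₁ z<k  = below z z<k
    ... | inj₂ refl = v , fk

  least : ∀ c x → f x c ≡ 0 → ∃[ y ] μʳ p [ c ∷ [] ]⇓ y
  least c x fx≡0 with y , fy≡0 , below ←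
    search c x 0 (λ _ ()) (trans (cong (λ y → f y c) (+-identityʳ x)) fx≡0) =
    y , ⇓μ (subst (p [ y ∷ c ∷ [] ]⇓_) fy≡0 (p⇓ _)) λ z z<y →
      let v , fz = below z z<y in v , subst (p [ z ∷ c ∷ [] ]⇓_) fz (p⇓ _)

  zero-of : ∀ c y → μʳ p [ c ∷ [] ]⇓ y → f y c ≡ 0
  zero-of c y (⇓μ fy⇓0 _) = ⇓-deterministic (p⇓ _) fy⇓0

-- Parity and halving

isZero : ℕ → ℕ
isZero zero    = 1
isZero (suc _) = 0

odd : ℕ → ℕ
odd zero          = 0
odd (suc zero)    = 1
odd (suc (suc n)) = odd n

odd-suc : ∀ n → odd (suc n) ≡ isZero (odd n)
odd-suc zero          = refl
odd-suc (suc zero)    = refl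
odd-suc (suc (suc n)) = odd-suc n

⌊1+n/2⌋ : ∀ n → ⌊ suc n /2⌋ ≡ odd n + ⌊ n /2⌋
⌊1+n/2⌋ zero          = refl
⌊1+n/2⌋ (suc zero)    = refl
⌊1+n/2⌋ (suc (suc n)) = trans (cong suc (⌊1+n/2⌋ n)) (sym (+-suc (odd n) ⌊ n /2⌋))

odd-n+n : ∀ n → odd (n + n) ≡ 0
odd-n+n zero    = refl
odd-n+n (suc n) = trans (cong (odd ∘ suc) (+-suc n n)) (odd-n+n n)

odd-1+n+n : ∀ n → odd (suc (n + n)) ≡ 1
odd-1+n+n n = trans (odd-suc (n + n)) (cong isZero (odd-n+n n))

even-or-odd : ∀ m → ∃[ n ] (m ≡ n + n ⊎ m ≡ suc (n + n))
even-or-odd zero = 0 , inj₁ refl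
even-or-odd (suc m) with even-or-odd m
... | n , inj₁ refl = n , inj₂ refl
... | n , inj₂ refl = suc n , inj₁ (cong suc (sym (+-suc n n)))

n+n-injective : ∀ {m n} → m + m ≡ n + n → m ≡ n
n+n-injective {m} {n} eq =
  trans (n≡⌊n+n/2⌋ m) (trans (cong ⌊_/2⌋ eq) (sym (n≡⌊n+n/2⌋ n)))

n+n≢1+m+m : ∀ n m → n + n ≢ suc (m + m)
n+n≢1+m+m n m eq = 0≢1+n (trans (sym (odd-n+n n)) (trans (cong odd eq) (odd-1+n+n m)))

odd-computable : Computable odd
odd-computable = unary (prec-computable _ (constⁿ-computable 0)
  (∘ⁿ-computable (shift-computable isZero (const-computable 0)) (proj-computable (suc zero)))
  (λ k _ → odd-suc k))

⌊/2⌋-computable : Computable ⌊_/2⌋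
⌊/2⌋-computable = unary (prec-computable _ (constⁿ-computable 0)
  (∘₂ⁿ-computable _+_ +-computable (∘ⁿ-computable odd-computable (proj-computable zero))
    (proj-computable (suc zero)))
  (λ k _ → ⌊1+n/2⌋ k))

-- Digits of coded strings

-- In bijective base 2 the least significant digit of a positive c is 1 or 2
-- according to the parity of c ∸ 1; digit 0 stands for "out of range".
lowDigit : ℕ → ℕ
lowDigit zero    = 0
lowDigit (suc c) = suc (odd c)

-- Both 1 + 2n and 2 + 2n go to n, which removes either digit; 0 is fixed, so reading past the end
-- of a string keeps giving digit 0.
dropDigit : ℕ → ℕ
dropDigit c = ⌊ pred c /2⌋

digit : ℕ → ℕ → ℕ
digit m c = lowDigit (fold c dropDigit m)

bit : Bool → ℕ
bit false = 1
bit true  = 2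

digit-computable : Computable₂ digit
digit-computable = ∘ⁿ-computable (shift-computable lowDigit (∘-computable suc-computable odd-computable))
  (fold-computable (shift-computable dropDigit ⌊/2⌋-computable))

-- `fold` applies its last step outermost; rewriting it as an iteration moves one step innermost,
-- where it removes the head of the string.
digit-suc : ∀ m c → digit (suc m) c ≡ digit m (dropDigit c)
digit-suc m c = cong lowDigit (trans (iterate-is-fold c dropDigit (suc m))
  (sym (iterate-is-fold (dropDigit c) dropDigit m)))

2*n≡n+n : ∀ n → 2 * n ≡ n + n
2*n≡n+n n = cong (n +_) (+-identityʳ n)

lowDigit-code : ∀ b σ → lowDigit (code (b ∷ σ)) ≡ bit b
lowDigit-code false σ = cong suc (trans (cong odd (2*n≡n+n (code σ))) (odd-n+n (code σ)))
lowDigit-code true  σ =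
  cong suc (trans (cong (odd ∘ suc) (2*n≡n+n (code σ))) (odd-1+n+n (code σ)))

dropDigit-code : ∀ b σ → dropDigit (code (b ∷ σ)) ≡ code σ
dropDigit-code false σ =
  trans (cong ⌊_/2⌋ (2*n≡n+n (code σ))) (sym (n≡⌊n+n/2⌋ (code σ)))
dropDigit-code true  σ =
  trans (cong (⌊_/2⌋ ∘ suc) (2*n≡n+n (code σ))) (sym (n≡⌈n+n/2⌉ (code σ)))

digit-∷ : ∀ m b σ → digit (suc m) (code (b ∷ σ)) ≡ digit m (code σ)
digit-∷ m b σ = trans (digit-suc m _) (cong (digit m) (dropDigit-code b σ))

digit-[] : ∀ m → digit m (code []) ≡ 0
digit-[] zero    = refl
digit-[] (suc m) = trans (digit-suc m 0) (digit-[] m)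

digit-< : ∀ C {m N} → m < N → digit m (code (applyUpTo C N)) ≡ bit (C m)
digit-< C {zero}  {suc N} _         = lowDigit-code (C 0) _
digit-< C {suc m} {suc N} (s≤s m<N) =
  trans (digit-∷ m (C 0) _) (digit-< (C ∘ suc) m<N)

digit-≥ : ∀ C {m N} → N ≤ m → digit m (code (applyUpTo C N)) ≡ 0
digit-≥ C {m}             z≤n       = digit-[] m
digit-≥ C {suc m} {suc N} (s≤s N≤m) =
  trans (digit-∷ m (C 0) _) (digit-≥ (C ∘ suc) N≤m)

digit-cases : ∀ C m N → let d = digit m (code (applyUpTo C N)) in d ≡ 0 ⊎ d ≡ bit (C m)
digit-cases C m N with m <? N
... | yes m<N = inj₂ (digit-< C m<N)
... | no  m≮N = inj₁ (digit-≥ C (≮⇒≥ m≮N))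

-- Two digits in {0,1,2} sum to 3 exactly when both are in range and they differ.
notThree : ℕ → ℕ
notThree 3 = 0
notThree _ = 1

notThree≡0 : ∀ n → notThree n ≡ 0 → n ≡ 3
notThree≡0 3 _ = refl

notThree-computable : Computable notThree
notThree-computable = shift-computable _ (shift-computable _ (shift-computable _
  (shift-computable _ (const-computable 1))))

bit-not : ∀ b → bit (not b) + bit b ≡ 3
bit-not false = refl
bit-not true  = refl

-- The sum is 0, `bit b` or twice `bit b`, hence one of 0, 1, 2 and 4.
equal-bits-sum≢3 : ∀ {d e} b → d ≡ 0 ⊎ d ≡ bit b → e ≡ 0 ⊎ e ≡ bit b → d + e ≢ 3
equal-bits-sum≢3 false (inj₁ refl) (inj₁ refl) ()
equal-bits-sum≢3 false (inj₁ refl) (inj₂ refl) ()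
equal-bits-sum≢3 false (inj₂ refl) (inj₁ refl) ()
equal-bits-sum≢3 false (inj₂ refl) (inj₂ refl) ()
equal-bits-sum≢3 true  (inj₁ refl) (inj₁ refl) ()
equal-bits-sum≢3 true  (inj₁ refl) (inj₂ refl) ()
equal-bits-sum≢3 true  (inj₂ refl) (inj₁ refl) ()
equal-bits-sum≢3 true  (inj₂ refl) (inj₂ refl) ()

-- 1-generic sets

applyUpTo-⊑ : ∀ (A C : 2^ω) {M N} → M ≤ N → (∀ m → m < M → A m ≡ C m) →
  applyUpTo A M ⊑ applyUpTo C N
applyUpTo-⊑ A C z≤n       _   = []
applyUpTo-⊑ A C (s≤s M≤N) A≗C =
  A≗C 0 z<s ∷ applyUpTo-⊑ (A ∘ suc) (C ∘ suc) M≤N (λ m m<M → A≗C (suc m) (s<s m<M))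

flipAt : ℕ → 2^ω → 2^ω
flipAt a A m with m ≟ a
... | yes _ = not (A m)
... | no  _ = A m

flipAt-≡ : ∀ a A → flipAt a A a ≡ not (A a)
flipAt-≡ a A with a ≟ a
... | yes _   = refl
... | no  a≢a = ⊥-elim (a≢a refl)

flipAt-≢ : ∀ {a m} A → m ≢ a → flipAt a A m ≡ A m
flipAt-≢ {a} {m} A m≢a with m ≟ a
... | yes m≡a = ⊥-elim (m≢a m≡a)
... | no  _   = refl

-- Zero exactly when the string coded by `c` is defined at both `g x` and `h x` and has different
-- bits there; zero is the value that a μ-search over `x` looks for.
differ : (g h : ℕ → ℕ) → ℕ → ℕ → ℕ
differ g h x c = notThree (digit (g x) c + digit (h x) c)

differ-computable : ∀ {g h} → Computable g → Computable h → Computable₂ (differ g h)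
differ-computable cg ch = ∘ⁿ-computable notThree-computable (∘₂ⁿ-computable _+_ +-computable
  (∘₂ⁿ-computable digit digit-computable (∘ⁿ-computable cg (proj-computable zero))
    (proj-computable (suc zero)))
  (∘₂ⁿ-computable digit digit-computable (∘ⁿ-computable ch (proj-computable zero))
    (proj-computable (suc zero))))

differ-sound : ∀ g h A x N → differ g h x (code (applyUpTo A N)) ≡ 0 → A (g x) ≢ A (h x)
differ-sound g h A x N differ≡0 Agx≡Ahx = equal-bits-sum≢3 (A (g x))
  (digit-cases A (g x) N)
  (subst (λ b → d ≡ 0 ⊎ d ≡ bit b) (sym Agx≡Ahx) (digit-cases A (h x) N))
  (notThree≡0 _ differ≡0)
  where
  d = digit (h x) (code (applyUpTo A N))

-- The length `suc (g x + h x)` puts both positions in range, and the flip at `g x` leaves the bit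
-- at `h x` alone.
differ-flipAt : ∀ g h A x → A (g x) ≡ A (h x) → h x ≢ g x →
  differ g h x (code (applyUpTo (flipAt (g x) A) (suc (g x + h x)))) ≡ 0
differ-flipAt g h A x Agx≡Ahx hx≢gx = cong notThree (trans
  (cong₂ _+_
    (trans (digit-< C (s≤s (m≤m+n (g x) (h x)))) (cong bit (flipAt-≡ (g x) A)))
    (trans (digit-< C (s≤s (m≤n+m (h x) (g x))))
      (cong bit (trans (flipAt-≢ A hx≢gx) (sym Agx≡Ahx)))))
  (bit-not (A (g x))))
  where
  C = flipAt (g x) A

agree⇒eventually-equal : ∀ {A g h} → 1-Generic A → Computable g → Computable h →
  (∀ x → A (g x) ≡ A (h x)) → ∃[ N ] (∀ x → N ≤ g x → h x ≡ g x)
agree⇒eventually-equal {A} {g} {h} generic cg ch agree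
  with p , spec ← μ-computable (differ g h) (differ-computable cg ch)
  with generic (λ σ → ∃[ y ] p [ code σ ∷ [] ]⇓ y) (p , λ _ → mk⇔ id id)
-- The search on `σ` found an `x` at which bits of `σ`, hence of `A`, differ.
... | σ , σ≺A , inj₁ (x , p⇓x) = ⊥-elim (differ-sound g h A x (length σ)
  (subst (λ τ → differ g h x (code τ) ≡ 0) σ≺A (proj₂ (spec (code σ)) x p⇓x)) (agree x))
... | σ , σ≺A , inj₂ avoid = length σ , eventually
  where
  eventually : ∀ x → length σ ≤ g x → h x ≡ g x
  eventually x ∣σ∣≤gx with h x ≟ g x
  ... | yes hx≡gx = hx≡gx
  -- Flipping `A` at `g x`, beyond `σ`, yields an extension of `σ` in the c.e. set. Only `g x` has
  -- to be large; `h x` may even lie inside `σ`.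
  ... | no  hx≢gx = ⊥-elim (avoid _
    (subst (_⊑ _) (sym σ≺A) (applyUpTo-⊑ A _
      (≤-trans ∣σ∣≤gx (≤-trans (m≤m+n (g x) (h x)) (n≤1+n _)))
      (λ m m<∣σ∣ → sym (flipAt-≢ A (<⇒≢ (<-≤-trans m<∣σ∣ ∣σ∣≤gx))))))
    (proj₁ (spec _) x (differ-flipAt g h A x (agree x) hx≢gx)))

-- The antichain

-- The number 2^i (2k+1); row `i` consists of the numbers with exactly `i` factors 2.
sparse : ℕ → ℕ → ℕ
sparse zero    k = suc (k + k)
sparse (suc i) k = sparse i k + sparse i k

-- Halving both sides in step leaves an odd number equal to an even one.
sparse-disjoint : ∀ i j {k l} → i ≢ j → sparse i k ≢ sparse j l
sparse-disjoint zero    zero    i≢j _ = i≢j refl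
sparse-disjoint zero    (suc j) {k} {l} _   eq = n+n≢1+m+m (sparse j l) k (sym eq)
sparse-disjoint (suc i) zero    {k} {l} _   eq = n+n≢1+m+m (sparse i k) l eq
sparse-disjoint (suc i) (suc j) i≢j eq =
  sparse-disjoint i j (i≢j ∘ cong suc) (n+n-injective eq)

k≤sparse : ∀ i k → k ≤ sparse i k
k≤sparse zero    k = ≤-trans (m≤m+n k k) (n≤1+n _)
k≤sparse (suc i) k = ≤-trans (k≤sparse i k) (m≤m+n _ _)

sparse-computable : ∀ i → Computable (sparse i)
sparse-computable zero    = ∘-computable suc-computable double-computable
sparse-computable (suc i) = ∘-computable double-computable (sparse-computable i)

sparseIf : ℕ → ℕ → ℕ → ℕ
sparseIf i zero    k = k
sparseIf i (suc _) k = sparse i k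

sparseIf-computable : ∀ i → Computable₂ (sparseIf i)
sparseIf-computable i = prec-computable _ (proj-computable zero)
  (∘ⁿ-computable (sparse-computable i) (proj-computable (suc (suc zero)))) (λ _ _ → refl)

-- Even arguments run through all of ω, odd ones through row `i`, which is thereby listed a second
-- time.
copies : ℕ → ℕ → ℕ
copies i x = sparseIf i (odd x) ⌊ x /2⌋

copies-computable : ∀ i → Computable (copies i)
copies-computable i =
  ∘₂-computable (sparseIf i) (sparseIf-computable i) odd-computable ⌊/2⌋-computable

copies-n+n : ∀ i n → copies i (n + n) ≡ n
copies-n+n i n = cong₂ (sparseIf i) (odd-n+n n) (sym (n≡⌊n+n/2⌋ n))

copies-1+k+k : ∀ i k → copies i (suc (k + k)) ≡ sparse i k
copies-1+k+k i k = cong₂ (sparseIf i) (odd-1+n+n k) (sym (n≡⌈n+n/2⌉ k))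

-- An odd preimage would have its value in row `j`, which is disjoint from row `i`.
copies-unique : ∀ {i j} k y → i ≢ j → copies j y ≡ sparse i k → y ≡ sparse i k + sparse i k
copies-unique {i} {j} k y i≢j eq with even-or-odd y
... | n , inj₁ refl = cong (λ m → m + m) (trans (sym (copies-n+n j n)) eq)
... | n , inj₂ refl =
  ⊥-elim (sparse-disjoint i j i≢j (trans (sym eq) (copies-1+k+k j n)))

corollary4p5 : (A : 2^ω) → 1-Generic A →
    Σ[ B ∈ (ℕ → 2^ω) ]
    ((∀ i → B i ≡m A) × (∀ i j → i ≢ j → ¬ (B i ≤₁ B j)))
corollary4p5 A generic = (λ i → A ∘ copies i) , equivalent , incomparable
  where
  equivalent : ∀ i → (A ∘ copies i) ≡m A
  equivalent i =
    (copies i , copies-computable i , λ _ → mk⇔ id id) ,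
    -- Doubling is a right inverse of `copies i`.
    ((λ n → n + n) , double-computable , λ n →
      mk⇔ (trans (cong A (copies-n+n i n))) (trans (cong A (sym (copies-n+n i n)))))

  incomparable : ∀ i j → i ≢ j → ¬ ((A ∘ copies i) ≤₁ (A ∘ copies j))
  incomparable i j i≢j (f , cf , f-injective , reduces)
    -- The reduction says that `A` agrees along `copies i` and `copies j ∘ f`.
    with N , eventually ← agree⇒eventually-equal generic (copies-computable i)
                            (∘-computable (copies-computable j) cf) (λ x → ⇔→≡ (reduces x)) =
    -- `copies i` takes the value `n` at both `n + n` and `suc (N + N)`; `f` identifies these two
    -- arguments although their parities differ.
    n+n≢1+m+m n N (f-injective (trans (image (n + n) (copies-n+n i n))
      (sym (image (suc (N + N)) (copies-1+k+k i N)))))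
    where
    n = sparse i N

    image : ∀ x → copies i x ≡ n → f x ≡ n + n
    image x eq = copies-unique N (f x) i≢j
      -- Choosing `n` as entry `N` of row `i` guarantees `N ≤ n`, the bound that `eventually`
      -- requires.
      (trans (eventually x (subst (N ≤_) (sym eq) (k≤sparse i N))) eq)
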